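{- Let $C$ be a finite set of level constraints in normal form with $\mathcal{I}(C) \cap \mathcal{I}_{fresh} = \emptyset$. If $C; id \leadsto^* \emptyset; \theta$ by a finite sequence of unification steps, then $\theta$ is a most general unifier of $C$: $\theta \vDash C$, and for every level substitution $\tau$ with $\tau \vDash C$ there is a level substitution $\tau'$ such that $i\tau \simeq (i\theta)\tau'$ for all $i \in \mathcal{I}(C)$.
   Context: Levels: $l ::= i \mid \mathtt{z} \mid \mathtt{s}\,l \mid l \sqcup l'$, $i$ in an infinite totally ordered set $\mathcal{I}$ of level variables; $\simeq$ is the smallest congruence (closed under constructors and substitution of levels for variables) containing $i_1 \sqcup (i_2 \sqcup i_3) \approx (i_1 \sqcup i_2) \sqcup i_3$, $i_1 \sqcup i_2 \approx i_2 \sqcup i_1$, $\mathtt{s}(i_1 \sqcup i_2) \approx \mathtt{s}\,i_1 \sqcup \mathtt{s}\,i_2$, $i \sqcup \mathtt{s}\,i \approx \mathtt{s}\,i$, $i \sqcup \mathtt{z} \approx i$, $i \sqcup i \approx i$. Normal form of levels: $\mathtt{s}^k\,\mathtt{z} \sqcup (\sqcup_{i \in V} \mathtt{s}^{n_i}\,i)$ with $V$ a strictly increasing sequence of variables, $n_i \le k$; every $l$ has a unique normal form $\hat l \simeq l$. A constraint $l_1 = l_2$ is in normal form if both sides are in normal form, each variable occurring on both sides has the same exponent on both sides, and at least one exponent (of $\mathtt{z}$ or of a variable, on either side) is $0$; $\widehat{C}$ denotes putting each constraint of $C$ in normal form (normalize both sides, for a variable on both sides drop the occurrence with smaller exponent,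 then subtract the minimum exponent from all exponents). $\theta \vDash C$ means $l_1\theta \simeq l_2\theta$ for all $l_1 = l_2 \in C$. $id$ is the identity substitution. For substitutions: $dom\,\theta = \{i \mid i\theta \ne i\}$; $\mathcal{I}(l)$ is the set of variables of $l$, $\mathcal{I}(C)$ those of $C$; $range\,\theta = \bigcup_{i \in dom\,\theta} \mathcal{I}(i\theta)$; $\mathcal{I}(\theta) = dom\,\theta \cup range\,\theta$; $\widehat{\theta} = \{i \mapsto \widehat{i\theta}\}_{i \in dom\,\theta}$; $\theta\{l/j\} = \{i \mapsto (i\theta)\{l/j\}\}_{i \in dom\,\theta}$; $\mathcal{I}_{fresh} \subsetneq \mathcal{I}$ is a fixed infinite set of fresh variables. In normal-form levels, $\mathtt{z} \sqcup i$ means $\mathtt{s}^0\mathtt{z} \sqcup \mathtt{s}^0 i$, and "$\mathtt{s}^m\,x \in l$" means $\mathtt{s}^m\,x$ is a summand of $l$. The unification steps on pairs $C;\theta$ are: (Trivial) $\{l = l\} \cup C; \theta \leadsto C; \theta$. (Orient) $\{l = l'\} \cup C; \theta \leadsto \{l' = l\} \cup C; \theta$ if $l'$ is $\mathtt{z}$ or $\mathtt{z} \sqcup i$. (Eliminate 1) $\{\mathtt{z} \sqcup i = l\} \cup C; \theta \leadsto \widehat{C\{l/i\}}; (\widehat{\theta\{l/i\}}, i \mapsto l)$ if $i$ does not occur in $l$. (Eliminate 2) $\{\mathtt{z} \sqcup i = l\} \cup C; \theta \leadsto \widehat{C\{l'/i\}}; (\widehat{\theta\{l'/i\}}, i \mapsto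 l')$ where $l' = l\{i'/i\}$ for some $i' \in \mathcal{I}_{fresh} \setminus \mathcal{I}(i, l, C, \theta)$, if $\mathtt{s}^0\,i \in l$. (Decompose) $\{\mathtt{z} = \mathtt{z} \sqcup (\sqcup_{i \in V} i)\} \cup C; \theta \leadsto \{\mathtt{z} \sqcup i = \mathtt{z}\}_{i \in V} \cup C; \theta$. (Clash) $\{\mathtt{z} = l\} \cup C; \theta \leadsto \bot$ if $\mathtt{s}^n\,i \in l$ or $\mathtt{s}^n\,\mathtt{z} \in l$ for some $n \ne 0$. -}

module Defs where

open import Data.Bool.Base using (if_then_else_)
open import Data.List.Base using (List; []; _∷_; _++_; map; filter; foldr; concatMap)
open import Data.List.Membership.Propositional using (_∈_; _∉_)
open import Data.List.Relation.Binary.BagAndSetEquality using (_∼[_]_; set)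
open import Data.List.Relation.Binary.Pointwise using (Pointwise)
open import Data.List.Relation.Unary.All using (All)
open import Data.List.Relation.Unary.AllPairs using (AllPairs)
open import Data.List.Relation.Unary.Any using (any?)
open import Data.Nat.Base as ℕ using (ℕ; zero; suc; _∸_; _⊓_)
import Data.Nat.Properties as ℕ
open import Data.Product.Base using (_×_; _,_; proj₁; proj₂; ∃-syntax)
open import Data.Sum.Base using (_⊎_)
open import Level as Universe using () renaming (Level to ULevel; suc to lsuc; _⊔_ to _⊔ᵘ_)
open import Relation.Binary.Construct.Closure.ReflexiveTransitive using (Star)
open import Relation.Binary.Core using (Rel)
open import Relation.Binary.PropositionalEquality using (_≡_; _≢_; refl; cong)
open import Relation.Binary.Structures using (IsStrictTotalOrder)
open import Relation.Nullary.Decidable using (Dec; yes; no; does; map′; _×-dec_; ¬?)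
open import Relation.Nullary.Negation using (¬_)
open import Relation.Unary using (Pred; U)

-- A predicate is infinite when no finite list exhausts it.

Infinite : ∀ {a p} {A : Set a} → Pred A p → Set (a ⊔ᵘ p)
Infinite P = ∀ xs → ∃[ x ] P x × x ∉ xs

record LevelVariables (a ℓ p : ULevel) : Set (lsuc (a ⊔ᵘ ℓ ⊔ᵘ p)) where
  infix 4 _<_
  field
    𝓘                  : Set a
    _<_                : Rel 𝓘 ℓ
    isStrictTotalOrder : IsStrictTotalOrder _≡_ _<_
    infinite           : Infinite {A = 𝓘} U
    Fresh              : Pred 𝓘 p
    fresh-infinite     : Infinite Fresh
    fresh-proper       : ∃[ i ] ¬ Fresh i

module Unification {a ℓ p} (𝓥 : LevelVariables a ℓ p) where

  open LevelVariables 𝓥 public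
  open IsStrictTotalOrder isStrictTotalOrder using (_≟_)

  infixl 6 _⊔_
  data Level : Set a where
    var : 𝓘 → Level
    z   : Level
    s   : Level → Level
    _⊔_ : Level → Level → Level

  s^[_]_ : ℕ → Level → Level
  s^[ zero  ] l = l
  s^[ suc n ] l = s (s^[ n ] l)

  vars : Level → List 𝓘
  vars (var i) = i ∷ []
  vars z       = []
  vars (s l)   = vars l
  vars (l ⊔ m) = vars l ++ vars m

  -- Substitutions are total; a variable outside the domain is mapped to itself.

  Subst : Set a
  Subst = 𝓘 → Level

  id : Subst
  id = var

  infixl 8 _[_]
  _[_] : Level → Subst → Level
  var i   [ θ ] = θ i
  z       [ θ ] = z
  s l     [ θ ] = s (l [ θ ])
  (l ⊔ m) [ θ ] = l [ θ ] ⊔ m [ θ ]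

  infixl 7 _,_↦_
  _,_↦_ : Subst → 𝓘 → Level → Subst
  (θ , i ↦ l) j = if does (j ≟ i) then l else θ j

  infix 9 _/_
  _/_ : Level → 𝓘 → Subst
  l / i = id , i ↦ l

  infix 4 _≃_
  data _≃_ : Level → Level → Set a where
    ≃-refl  : ∀ {l} → l ≃ l
    ≃-sym   : ∀ {l m} → l ≃ m → m ≃ l
    ≃-trans : ∀ {l m n} → l ≃ m → m ≃ n → l ≃ n
    ≃-s     : ∀ {l m} → l ≃ m → s l ≃ s m
    ≃-⊔     : ∀ {l l′ m m′} → l ≃ l′ → m ≃ m′ → l ⊔ m ≃ l′ ⊔ m′
    ≃-subst : ∀ {l m} (σ : Subst) → l ≃ m → l [ σ ] ≃ m [ σ ]
    assoc   : ∀ i₁ i₂ i₃ → var i₁ ⊔ (var i₂ ⊔ var i₃) ≃ (var i₁ ⊔ var i₂) ⊔ var i₃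
    comm    : ∀ i₁ i₂ → var i₁ ⊔ var i₂ ≃ var i₂ ⊔ var i₁
    s-distr : ∀ i₁ i₂ → s (var i₁ ⊔ var i₂) ≃ s (var i₁) ⊔ s (var i₂)
    absorb  : ∀ i → var i ⊔ s (var i) ≃ s (var i)
    unit    : ∀ i → var i ⊔ z ≃ var i
    idem    : ∀ i → var i ⊔ var i ≃ var i

  -- (i , n) stands for the summand sⁿ i.

  Summands : Set a
  Summands = List (𝓘 × ℕ)

  ⨆ : 𝓘 × ℕ → Summands → Level
  ⨆ (i , n) []      = s^[ n ] var i
  ⨆ (i , n) (v ∷ V) = s^[ n ] var i ⊔ ⨆ v V

  -- With no variables, the form sᵏ z ⊔ (⊔ᵢ sⁿⁱ i) is just sᵏ z.

  form : ℕ → Summands → Level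
  form k []      = s^[ k ] z
  form k (v ∷ V) = s^[ k ] z ⊔ ⨆ v V

  StrictlyIncreasing : List 𝓘 → Set (a ⊔ᵘ ℓ)
  StrictlyIncreasing = AllPairs _<_

  record NormalForm : Set (a ⊔ᵘ ℓ) where
    field
      const      : ℕ
      summands   : Summands
      increasing : StrictlyIncreasing (map proj₁ summands)
      bounded    : All (λ (_ , n) → n ℕ.≤ const) summands

    level : Level
    level = form const summands

  open NormalForm

  -- The (unique) normal form l̂ of l is characterised by l̂ being normal and l̂ ≃ l.

  infix 4 _IsNormalFormOf_
  _IsNormalFormOf_ : Level → Level → Set (a ⊔ᵘ ℓ)
  l̂ IsNormalFormOf l = (∃[ N ] l̂ ≡ level N) × l̂ ≃ l

  Constraint : Set a
  Constraint = Level × Level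

  Constraints : Set a
  Constraints = List Constraint

  varsᶜ : Constraints → List 𝓘
  varsᶜ = concatMap (λ (l , m) → vars l ++ vars m)

  substᶜ : Subst → Constraints → Constraints
  substᶜ θ = map (λ (l , m) → l [ θ ] , m [ θ ])

  infix 4 _⊨_
  _⊨_ : Subst → Constraints → Set a
  θ ⊨ C = All (λ (l , m) → l [ θ ] ≃ m [ θ ]) C

  exponents : ℕ → Summands → List ℕ
  exponents k V = k ∷ map proj₂ V

  IsNormalConstraint : Constraint → Set (a ⊔ᵘ ℓ)
  IsNormalConstraint (l , m) = ∃[ N ] ∃[ M ]
    l ≡ level N × m ≡ level M ×
    (∀ i n n′ → (i , n) ∈ summands N → (i , n′) ∈ summands M → n ≡ n′) ×
    0 ∈ exponents (const N) (summands N) ++ exponents (const M) (summands M)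

  -- The summands of V whose variable has no larger exponent in W.

  dropSmaller : Summands → Summands → Summands
  dropSmaller W V =
    filter (λ (i , n) → ¬? (any? (λ (j , m) → (i ≟ j) ×-dec (n ℕ.<? m)) W)) V

  lower : ℕ → Summands → Summands
  lower e = map (λ (i , n) → i , n ∸ e)

  normalize : NormalForm → NormalForm → Constraint
  normalize N M = form (const N ∸ e) (lower e V) , form (const M ∸ e) (lower e W)
    where
    V = dropSmaller (summands M) (summands N)
    W = dropSmaller (summands N) (summands M)
    e = foldr _⊓_ (const N) (exponents (const N) V ++ exponents (const M) W)

  infix 4 _IsHatOf_
  _IsHatOf_ : Constraint → Constraint → Set (a ⊔ᵘ ℓ)
  ĉ IsHatOf (l , m) = ∃[ N ] ∃[ M ]
    level N IsNormalFormOf l × level M IsNormalFormOf m × ĉ ≡ normalize N M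

  infix 4 _IsHatOfᶜ_ _IsHatOfˢ_
  _IsHatOfᶜ_ : Constraints → Constraints → Set (a ⊔ᵘ ℓ)
  _IsHatOfᶜ_ = Pointwise _IsHatOf_

  Dom : Subst → Pred 𝓘 a
  Dom θ i = θ i ≢ var i

  Range : Subst → Pred 𝓘 a
  Range θ j = ∃[ i ] Dom θ i × j ∈ vars (θ i)

  Varsˢ : Subst → Pred 𝓘 a
  Varsˢ θ i = Dom θ i ⊎ Range θ i

  var? : ∀ l i → Dec (l ≡ var i)
  var? (var j) i = map′ (cong var) (λ { refl → refl }) (j ≟ i)
  var? z       i = no λ ()
  var? (s _)   i = no λ ()
  var? (_ ⊔ _) i = no λ ()

  -- θ{l/j} only acts on the images of the variables in the domain of θ: unlike
  -- in a composition of substitutions, j itself stays fixed if outside of it.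

  substˢ : Subst → Subst → Subst
  substˢ σ θ i = if does (var? (θ i) i) then var i else θ i [ σ ]

  _IsHatOfˢ_ : Subst → Subst → Set (a ⊔ᵘ ℓ)
  θ̂ IsHatOfˢ θ = ∀ i → (Dom θ i → θ̂ i IsNormalFormOf θ i) × (¬ Dom θ i → θ̂ i ≡ var i)

  data _SummandOf_ (t : Level) : Level → Set a where
    here  : t SummandOf t
    left  : ∀ {l m} → t SummandOf l → t SummandOf (l ⊔ m)
    right : ∀ {l m} → t SummandOf m → t SummandOf (l ⊔ m)

  data State : Set a where
    _︔_  : Constraints → Subst → State
    clash : State

  -- Finite sets of constraints are lists up to set equality: {c} ∪ C in the
  -- source of a step is any list with the same elements as c ∷ C.

  infix 4 _≈_∪_
  _≈_∪_ : Constraints → Constraint → Constraints → Set a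
  C₀ ≈ c ∪ C = C₀ ∼[ set ] c ∷ C

  infix 3 _︔_
  infix 2 _⇝_ _⇝*_
  data _⇝_ : State → State → Set (a ⊔ᵘ ℓ ⊔ᵘ p) where

    trivial : ∀ {C₀ C θ l} → C₀ ≈ (l , l) ∪ C →
              (C₀ ︔ θ) ⇝ (C ︔ θ)

    orient : ∀ {C₀ C θ l l′} → C₀ ≈ (l , l′) ∪ C →
             l′ ≡ z ⊎ (∃[ i ] l′ ≡ z ⊔ var i) →
             (C₀ ︔ θ) ⇝ ((l′ , l) ∷ C ︔ θ)

    eliminate₁ : ∀ {C₀ C C′ θ θ′ i l} → C₀ ≈ (z ⊔ var i , l) ∪ C →
                 i ∉ vars l →
                 C′ IsHatOfᶜ substᶜ (l / i) C →
                 θ′ IsHatOfˢ substˢ (l / i) θ →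
                 (C₀ ︔ θ) ⇝ (C′ ︔ (θ′ , i ↦ l))

    eliminate₂ : ∀ {C₀ C C′ θ θ′ i i′ l} → C₀ ≈ (z ⊔ var i , l) ∪ C →
                 var i SummandOf l →
                 Fresh i′ →
                 i′ ∉ i ∷ vars l ++ varsᶜ C →
                 ¬ Varsˢ θ i′ →
                 let l′ = l [ var i′ / i ] in
                 C′ IsHatOfᶜ substᶜ (l′ / i) C →
                 θ′ IsHatOfˢ substˢ (l′ / i) θ →
                 (C₀ ︔ θ) ⇝ (C′ ︔ (θ′ , i ↦ l′))

    decompose : ∀ {C₀ C θ} V → StrictlyIncreasing V →
                C₀ ≈ (z , form 0 (map (_, 0) V)) ∪ C →
                (C₀ ︔ θ) ⇝ (map (λ i → z ⊔ var i , z) V ++ C ︔ θ)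

    clashes : ∀ {C₀ C θ l} → C₀ ≈ (z , l) ∪ C →
              (∃[ n ] n ≢ 0 × ((∃[ i ] (s^[ n ] var i) SummandOf l) ⊎ (s^[ n ] z) SummandOf l)) →
              (C₀ ︔ θ) ⇝ clash

  _⇝*_ : State → State → Set (a ⊔ᵘ ℓ ⊔ᵘ p)
  _⇝*_ = Star _⇝_

  MostGeneralUnifier : Subst → Constraints → Set a
  MostGeneralUnifier θ C =
    θ ⊨ C ×
    (∀ (τ : Subst) → τ ⊨ C →
     ∃[ τ′ ] (∀ i → i ∈ varsᶜ C → τ i ≃ θ i [ τ′ ]))

{-# OPTIONS --safe #-}
module Submission where

-- Levels modulo ≃ embed into the max-plus functions on ℕ-valuations: l ≃ m
-- holds as soon as l and m take the same values, since a valuation that is large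
-- at one variable and 0 elsewhere exposes the exponent of that variable. So ⊨
-- can be checked valuation by valuation. Call x a solution of C ︔ θ when it
-- solves C and x i = ⟦ θ i ⟧ x for all i. Unification steps preserve solutions in
-- both directions, except that a step with a fresh variable i′ needs the value
-- of i copied to i′. Along a run, Dom θ stays disjoint from the variables of C
-- and from those of every θ k, so the final θ is idempotent: each of its
-- instances is a solution of the final state, hence of C. Conversely a unifier
-- τ of C yields solutions of the initial state, which pushed forward say that
-- τ factors through θ.

open import Defs
open import Data.List.Base using (List; []; _∷_; _++_; map; foldr)
open import Data.List.Membership.Propositional using (_∈_; _∉_; find)
open import Data.List.Membership.Propositional.Properties
  using (∈-map⁺; ∈-map⁻; ∈-filter⁺; ∈-filter⁻; ∈-++⁺ˡ; ∈-++⁺ʳ; ∈-++⁻)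
open import Data.List.Properties using (map-∘)
open import Data.List.Relation.Binary.Pointwise using ([]; _∷_)
open import Data.List.Relation.Unary.All as All using (All; []; _∷_)
open import Data.List.Relation.Unary.All.Properties
  using (anti-mono; map⁺; map⁻; ++⁺; ++⁻)
open import Data.List.Relation.Unary.AllPairs using ([]; _∷_)
import Data.List.Relation.Unary.AllPairs.Properties as AllPairs
open import Data.List.Relation.Unary.Any using (here; there; any?)
open import Data.Nat.Base as ℕ using (ℕ; zero; suc; _+_; _∸_; _≤_; _⊓_; z≤n; s≤s)
import Data.Nat.Properties as ℕ
open import Data.Product.Base using (_×_; _,_; proj₁; proj₂; ∃-syntax)
open import Data.Sum.Base using (_⊎_; inj₁; inj₂; [_,_]′)
open import Function.Base using (_∘_; _$_; flip)
open import Function.Bundles using (Equivalence)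
import Level as Universe
open import Relation.Binary.Construct.Closure.ReflexiveTransitive using (ε; _◅_)
open import Relation.Binary.PropositionalEquality
  using (_≡_; _≢_; _≗_; refl; sym; trans; cong; cong₂; subst; subst₂; module ≡-Reasoning)
open import Relation.Binary.Structures using (IsStrictTotalOrder)
open import Relation.Nullary.Decidable using (Dec; yes; no; ¬?; _×-dec_; decidable-stable)
open import Relation.Nullary.Negation using (¬_; contradiction)

module MostGeneral {a ℓ p} (𝓥 : LevelVariables a ℓ p) where

  open Unification 𝓥
  open IsStrictTotalOrder isStrictTotalOrder using (_≟_; irrefl)
  open NormalForm

  -- Substitutions

  ↦-eq : ∀ θ i l → (θ , i ↦ l) i ≡ l
  ↦-eq θ i l with i ≟ i
  ... | yes _   = refl
  ... | no  i≢i = contradiction refl i≢i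

  ↦-neq : ∀ θ {i j} l → j ≢ i → (θ , i ↦ l) j ≡ θ j
  ↦-neq θ {i} {j} l j≢i with j ≟ i
  ... | yes j≡i = contradiction j≡i j≢i
  ... | no  _   = refl

  Dom? : ∀ θ i → Dec (Dom θ i)
  Dom? θ i = ¬? (var? (θ i) i)

  ¬Dom⇒var : ∀ θ {i} → ¬ Dom θ i → θ i ≡ var i
  ¬Dom⇒var θ {i} = decidable-stable (var? (θ i) i)

  substˢ-Dom : ∀ σ θ {i} → Dom θ i → substˢ σ θ i ≡ θ i [ σ ]
  substˢ-Dom σ θ {i} d with var? (θ i) i
  ... | yes e = contradiction e d
  ... | no  _ = refl

  substˢ-¬Dom : ∀ σ θ {i} → θ i ≡ var i → substˢ σ θ i ≡ var i
  substˢ-¬Dom σ θ {i} e with var? (θ i) i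
  ... | yes _ = refl
  ... | no  d = contradiction e d

  vars-subst⁻ : ∀ l σ {j} → j ∈ vars (l [ σ ]) → ∃[ k ] k ∈ vars l × j ∈ vars (σ k)
  vars-subst⁻ (var i) σ j∈ = i , here refl , j∈
  vars-subst⁻ (s l)   σ j∈ = vars-subst⁻ l σ j∈
  vars-subst⁻ (l ⊔ m) σ j∈ with ∈-++⁻ (vars (l [ σ ])) j∈
  ... | inj₁ j∈l = let k , k∈ , q = vars-subst⁻ l σ j∈l in k , ∈-++⁺ˡ k∈ , q
  ... | inj₂ j∈m = let k , k∈ , q = vars-subst⁻ m σ j∈m in k , ∈-++⁺ʳ (vars l) k∈ , q

  vars-subst⁺ : ∀ l σ {j k} → k ∈ vars l → j ∈ vars (σ k) → j ∈ vars (l [ σ ])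
  vars-subst⁺ (var i) σ (here refl) j∈ = j∈
  vars-subst⁺ (s l)   σ k∈ j∈ = vars-subst⁺ l σ k∈ j∈
  vars-subst⁺ (l ⊔ m) σ k∈ j∈ with ∈-++⁻ (vars l) k∈
  ... | inj₁ k∈l = ∈-++⁺ˡ (vars-subst⁺ l σ k∈l j∈)
  ... | inj₂ k∈m = ∈-++⁺ʳ (vars (l [ σ ])) (vars-subst⁺ m σ k∈m j∈)

  -- The case `j ≡ i` is separate because the eliminated variable may occur in `m`: every occurrence
  -- is replaced by `l`.
  vars-/ : ∀ m l {i j} → j ∉ vars l → j ≡ i ⊎ j ∉ vars m → j ∉ vars (m [ l / i ])
  vars-/ m l {i} {j} j∉l j∉m j∈ with vars-subst⁻ m (l / i) j∈
  ... | k , k∈m , j∈k with k ≟ i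
  ...   | yes _ = j∉l j∈k
  vars-/ m l j∉l (inj₁ refl) j∈ | k , k∈m , here refl | no k≢i = k≢i refl
  vars-/ m l j∉l (inj₂ j∉m)  j∈ | k , k∈m , here refl | no _   = j∉m k∈m

  swap-++ : ∀ {A : Set a} (xs ys : List A) {v} → v ∈ xs ++ ys → v ∈ ys ++ xs
  swap-++ xs ys v∈ = [ ∈-++⁺ʳ ys , ∈-++⁺ˡ ]′ (∈-++⁻ xs v∈)

  -- Each axiom has the same variables on both sides. Hence normalizing a level cannot bring back a
  -- variable that has been eliminated.
  ≃-vars : ∀ {l m} → l ≃ m → ∀ {j} → (j ∈ vars l → j ∈ vars m) × (j ∈ vars m → j ∈ vars l)
  ≃-vars ≃-refl = (λ q → q) , (λ q → q)
  ≃-vars (≃-sym e) = let f , g = ≃-vars e in g , f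
  ≃-vars (≃-trans e e′) = let f , g = ≃-vars e ; f′ , g′ = ≃-vars e′ in f′ ∘ f , g ∘ g′
  ≃-vars (≃-s e) = ≃-vars e
  ≃-vars (≃-⊔ {l} {l′} {m} {m′} e e′) =
    (λ q → [ ∈-++⁺ˡ ∘ proj₁ (≃-vars e) , ∈-++⁺ʳ (vars l′) ∘ proj₁ (≃-vars e′) ]′ (∈-++⁻ (vars l) q)) ,
    (λ q → [ ∈-++⁺ˡ ∘ proj₂ (≃-vars e) , ∈-++⁺ʳ (vars l) ∘ proj₂ (≃-vars e′) ]′ (∈-++⁻ (vars l′) q))
  ≃-vars (≃-subst {l} {m} σ e) =
    (λ q → let _ , k∈ , j∈ = vars-subst⁻ l σ q in vars-subst⁺ m σ (proj₁ (≃-vars e) k∈) j∈) ,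
    (λ q → let _ , k∈ , j∈ = vars-subst⁻ m σ q in vars-subst⁺ l σ (proj₂ (≃-vars e) k∈) j∈)
  ≃-vars (assoc i₁ i₂ i₃) = (λ q → q) , (λ q → q)
  ≃-vars (comm i₁ i₂) = swap-++ (i₁ ∷ []) (i₂ ∷ []) , swap-++ (i₂ ∷ []) (i₁ ∷ [])
  ≃-vars (s-distr i₁ i₂) = (λ q → q) , (λ q → q)
  ≃-vars (absorb i) = (λ { (here q) → here q ; (there q) → q }) , there
  ≃-vars (unit i) = (λ q → q) , (λ q → q)
  ≃-vars (idem i) = (λ { (here q) → here q ; (there q) → q }) , there

  -- The semantics of levels in (ℕ , max , suc)

  Valuation : Set a
  Valuation = 𝓘 → ℕ

  ⟦_⟧ : Level → Valuation → ℕ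
  ⟦ var i ⟧ x = x i
  ⟦ z ⟧     x = 0
  ⟦ s l ⟧   x = suc (⟦ l ⟧ x)
  ⟦ l ⊔ m ⟧ x = ⟦ l ⟧ x ℕ.⊔ ⟦ m ⟧ x

  ⟦⟧-cong : ∀ l {x y} → (∀ j → j ∈ vars l → x j ≡ y j) → ⟦ l ⟧ x ≡ ⟦ l ⟧ y
  ⟦⟧-cong (var i) e = e i (here refl)
  ⟦⟧-cong z       e = refl
  ⟦⟧-cong (s l)   e = cong suc (⟦⟧-cong l e)
  ⟦⟧-cong (l ⊔ m) e =
    cong₂ ℕ._⊔_ (⟦⟧-cong l (λ j → e j ∘ ∈-++⁺ˡ)) (⟦⟧-cong m (λ j → e j ∘ ∈-++⁺ʳ (vars l)))

  ⟦⟧-subst : ∀ l σ x → ⟦ l [ σ ] ⟧ x ≡ ⟦ l ⟧ (λ i → ⟦ σ i ⟧ x)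
  ⟦⟧-subst (var i) σ x = refl
  ⟦⟧-subst z       σ x = refl
  ⟦⟧-subst (s l)   σ x = cong suc (⟦⟧-subst l σ x)
  ⟦⟧-subst (l ⊔ m) σ x = cong₂ ℕ._⊔_ (⟦⟧-subst l σ x) (⟦⟧-subst m σ x)

  -- The semantic core of elimination: where `i` already has the value of `l`, the replacement is
  -- invisible.
  ⟦⟧-/ : ∀ m l {i x} → x i ≡ ⟦ l ⟧ x → ⟦ m [ l / i ] ⟧ x ≡ ⟦ m ⟧ x
  ⟦⟧-/ m l {i} {x} e = trans (⟦⟧-subst m (l / i) x) (⟦⟧-cong m λ j _ → at j)
    where
    at : ∀ j → ⟦ (l / i) j ⟧ x ≡ x j
    at j with j ≟ i
    ... | yes refl = sym e
    ... | no  _    = refl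

  ⟦⟧-s^ : ∀ n l x → ⟦ s^[ n ] l ⟧ x ≡ n + ⟦ l ⟧ x
  ⟦⟧-s^ zero    l x = refl
  ⟦⟧-s^ (suc n) l x = cong suc (⟦⟧-s^ n l x)

  -- Soundness of the semantics. The case `≃-subst` needs the induction hypothesis at another
  -- valuation, so all valuations are treated at once.
  ≃⇒≗ : ∀ {l m} → l ≃ m → ⟦ l ⟧ ≗ ⟦ m ⟧
  ≃⇒≗ ≃-refl x = refl
  ≃⇒≗ (≃-sym e) x = sym (≃⇒≗ e x)
  ≃⇒≗ (≃-trans e e′) x = trans (≃⇒≗ e x) (≃⇒≗ e′ x)
  ≃⇒≗ (≃-s e) x = cong suc (≃⇒≗ e x)
  ≃⇒≗ (≃-⊔ e e′) x = cong₂ ℕ._⊔_ (≃⇒≗ e x) (≃⇒≗ e′ x)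
  ≃⇒≗ (≃-subst {l} {m} σ e) x =
    trans (⟦⟧-subst l σ x) (trans (≃⇒≗ e _) (sym (⟦⟧-subst m σ x)))
  ≃⇒≗ (assoc i₁ i₂ i₃) x = sym (ℕ.⊔-assoc (x i₁) (x i₂) (x i₃))
  ≃⇒≗ (comm i₁ i₂) x = ℕ.⊔-comm (x i₁) (x i₂)
  ≃⇒≗ (s-distr i₁ i₂) x = refl
  ≃⇒≗ (absorb i) x = ℕ.m≤n⇒m⊔n≡n (ℕ.n≤1+n (x i))
  ≃⇒≗ (unit i) x = ℕ.⊔-identityʳ (x i)
  ≃⇒≗ (idem i) x = ℕ.⊔-idem (x i)

  -- The axioms mention variables only, so their instances at arbitrary levels
  -- are obtained by substituting for distinct variables.

  private
    i₁ i₂ i₃ : 𝓘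
    i₁ = proj₁ (infinite [])
    i₂ = proj₁ (infinite (i₁ ∷ []))
    i₃ = proj₁ (infinite (i₁ ∷ i₂ ∷ []))

    i₂≢i₁ : i₂ ≢ i₁
    i₂≢i₁ e = proj₂ (proj₂ (infinite (i₁ ∷ []))) (here e)

    i₃≢i₁ : i₃ ≢ i₁
    i₃≢i₁ e = proj₂ (proj₂ (infinite (i₁ ∷ i₂ ∷ []))) (here e)

    i₃≢i₂ : i₃ ≢ i₂
    i₃≢i₂ e = proj₂ (proj₂ (infinite (i₁ ∷ i₂ ∷ []))) (there (here e))

    σ₃ : Level → Level → Level → Subst
    σ₃ l m n = (λ _ → n) , i₂ ↦ m , i₁ ↦ l

    σ₃-i₁ : ∀ l m n → σ₃ l m n i₁ ≡ l
    σ₃-i₁ l m n = ↦-eq ((λ _ → n) , i₂ ↦ m) i₁ l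

    σ₃-i₂ : ∀ l m n → σ₃ l m n i₂ ≡ m
    σ₃-i₂ l m n = trans (↦-neq ((λ _ → n) , i₂ ↦ m) l i₂≢i₁) (↦-eq (λ _ → n) i₂ m)

    σ₃-i₃ : ∀ l m n → σ₃ l m n i₃ ≡ n
    σ₃-i₃ l m n = trans (↦-neq ((λ _ → n) , i₂ ↦ m) l i₃≢i₁) (↦-neq (λ _ → n) m i₃≢i₂)

  ⊔-assoc : ∀ l m n → l ⊔ (m ⊔ n) ≃ (l ⊔ m) ⊔ n
  ⊔-assoc l m n = subst₂ _≃_
    (cong₂ _⊔_ (σ₃-i₁ l m n) (cong₂ _⊔_ (σ₃-i₂ l m n) (σ₃-i₃ l m n)))
    (cong₂ _⊔_ (cong₂ _⊔_ (σ₃-i₁ l m n) (σ₃-i₂ l m n)) (σ₃-i₃ l m n))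
    (≃-subst (σ₃ l m n) (assoc i₁ i₂ i₃))

  ⊔-comm : ∀ l m → l ⊔ m ≃ m ⊔ l
  ⊔-comm l m = subst₂ _≃_
    (cong₂ _⊔_ (σ₃-i₁ l m z) (σ₃-i₂ l m z))
    (cong₂ _⊔_ (σ₃-i₂ l m z) (σ₃-i₁ l m z))
    (≃-subst (σ₃ l m z) (comm i₁ i₂))

  s-distrib-⊔ : ∀ l m → s (l ⊔ m) ≃ s l ⊔ s m
  s-distrib-⊔ l m = subst₂ _≃_
    (cong s (cong₂ _⊔_ (σ₃-i₁ l m z) (σ₃-i₂ l m z)))
    (cong₂ _⊔_ (cong s (σ₃-i₁ l m z)) (cong s (σ₃-i₂ l m z)))
    (≃-subst (σ₃ l m z) (s-distr i₁ i₂))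

  ⊔-idem : ∀ l → l ⊔ l ≃ l
  ⊔-idem l = ≃-subst (λ _ → l) (idem i₁)

  ⊔-identityʳ : ∀ l → l ⊔ z ≃ l
  ⊔-identityʳ l = ≃-subst (λ _ → l) (unit i₁)

  ⊔-absorb-s : ∀ l → l ⊔ s l ≃ s l
  ⊔-absorb-s l = ≃-subst (λ _ → l) (absorb i₁)

  -- The order on levels and completeness of the semantics

  infix 4 _≲_
  -- The semilattice order, encoded as an equation so that inequalities are derived within `≃`
  -- itself.
  _≲_ : Level → Level → Set a
  l ≲ m = l ⊔ m ≃ m

  ≲-trans : ∀ {l m n} → l ≲ m → m ≲ n → l ≲ n
  ≲-trans {l} {m} {n} l≲m m≲n =
    ≃-trans (≃-⊔ ≃-refl (≃-sym m≲n))
    (≃-trans (⊔-assoc l m n)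
    (≃-trans (≃-⊔ l≲m ≃-refl) m≲n))

  ≲-s : ∀ {l m} → l ≲ m → s l ≲ s m
  ≲-s {l} {m} l≲m = ≃-trans (≃-sym (s-distrib-⊔ l m)) (≃-s l≲m)

  z≲ : ∀ l → z ≲ l
  z≲ l = ≃-trans (⊔-comm z l) (⊔-identityʳ l)

  ≲-⊔ˡ : ∀ l m → l ≲ l ⊔ m
  ≲-⊔ˡ l m = ≃-trans (⊔-assoc l l m) (≃-⊔ (⊔-idem l) ≃-refl)

  ≲-⊔ʳ : ∀ l m → m ≲ l ⊔ m
  ≲-⊔ʳ l m = ≃-trans (≃-⊔ ≃-refl (⊔-comm l m)) (≃-trans (≲-⊔ˡ m l) (⊔-comm m l))

  ≲-lub : ∀ {l m n} → l ≲ n → m ≲ n → l ⊔ m ≲ n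
  ≲-lub {l} {m} {n} l≲n m≲n =
    ≃-trans (≃-sym (⊔-assoc l m n)) (≃-trans (≃-⊔ ≃-refl m≲n) l≲n)

  ≲-antisym : ∀ {l m} → l ≲ m → m ≲ l → l ≃ m
  ≲-antisym {l} {m} l≲m m≲l = ≃-trans (≃-sym m≲l) (≃-trans (⊔-comm m l) l≲m)

  ∈vars⇒≲ : ∀ {i} m → i ∈ vars m → var i ≲ m
  ∈vars⇒≲ (var i) (here refl) = ⊔-idem (var i)
  ∈vars⇒≲ (s m)   i∈ = ≲-trans (∈vars⇒≲ m i∈) (⊔-absorb-s m)
  ∈vars⇒≲ (l ⊔ m) i∈ with ∈-++⁻ (vars l) i∈
  ... | inj₁ i∈l = ≲-trans (∈vars⇒≲ l i∈l) (≲-⊔ˡ l m)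
  ... | inj₂ i∈m = ≲-trans (∈vars⇒≲ m i∈m) (≲-⊔ʳ l m)

  0ᵛ : Valuation
  0ᵛ _ = 0

  -- At the zero valuation the value of `m` is attained along one branch of its joins, and the
  -- successors on that branch dominate those of `s^[ n ] z`.
  ≤⇒s^z≲ : ∀ n m → n ≤ ⟦ m ⟧ 0ᵛ → s^[ n ] z ≲ m
  ≤⇒s^z≲ zero    m       _ = z≲ m
  ≤⇒s^z≲ (suc n) (s m)   (s≤s q) = ≲-s (≤⇒s^z≲ n m q)
  ≤⇒s^z≲ (suc n) (l ⊔ m) q with ℕ.⊔-sel (⟦ l ⟧ 0ᵛ) (⟦ m ⟧ 0ᵛ)
  ... | inj₁ e = ≲-trans (≤⇒s^z≲ (suc n) l (subst (suc n ≤_) e q)) (≲-⊔ˡ l m)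
  ... | inj₂ e = ≲-trans (≤⇒s^z≲ (suc n) m (subst (suc n ≤_) e q)) (≲-⊔ʳ l m)

  spike : 𝓘 → ℕ → Valuation
  spike i b j with j ≟ i
  ... | yes _ = b
  ... | no  _ = 0

  spike-eq : ∀ i b → spike i b i ≡ b
  spike-eq i b with i ≟ i
  ... | yes _   = refl
  ... | no  i≢i = contradiction refl i≢i

  spike-neq : ∀ {i j} b → j ≢ i → spike i b j ≡ 0
  spike-neq {i} {j} b j≢i with j ≟ i
  ... | yes j≡i = contradiction j≡i j≢i
  ... | no  _   = refl

  -- A large value at i exposes the exponent of i in m.
  ≤⇒s^var≲ : ∀ {i b} n m → ⟦ m ⟧ 0ᵛ ℕ.< n + b → n + b ≤ ⟦ m ⟧ (spike i b) → s^[ n ] var i ≲ m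
  ≤⇒s^var≲ n z q r = contradiction (ℕ.<-≤-trans q r) λ ()
  ≤⇒s^var≲ {i} {b} n (var j) q r with j ≟ i
  ... | no  _    = contradiction (ℕ.<-≤-trans q r) λ ()
  ... | yes refl with n
  ...   | zero   = ⊔-idem (var i)
  ...   | suc n  = contradiction r (ℕ.<⇒≱ (s≤s (ℕ.m≤n+m b n)))
  ≤⇒s^var≲ (suc n) (s m) (s≤s q) (s≤s r) = ≲-s (≤⇒s^var≲ n m q r)
  -- No successor is left to match, so an occurrence of `i` in `m` suffices. Without one, `m` has
  -- the same value at the spike and at zero, against `q` and `r`.
  ≤⇒s^var≲ {i} {b} zero (s m) q r with any? (i ≟_) (vars m)
  ... | yes i∈ = ∈vars⇒≲ (s m) i∈
  ... | no  i∉ = contradiction (ℕ.<-≤-trans q r) (ℕ.<-irrefl (cong suc (⟦⟧-cong m λ j j∈ →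
                   sym (spike-neq b λ { refl → i∉ j∈ }))))
  ≤⇒s^var≲ {i} {b} n (l ⊔ m) q r with ℕ.⊔-sel (⟦ l ⟧ (spike i b)) (⟦ m ⟧ (spike i b))
  ... | inj₁ e = ≲-trans (≤⇒s^var≲ n l (ℕ.≤-<-trans (ℕ.m≤m⊔n _ _) q) (subst (n + b ≤_) e r)) (≲-⊔ˡ l m)
  ... | inj₂ e = ≲-trans (≤⇒s^var≲ n m (ℕ.≤-<-trans (ℕ.m≤n⊔m (⟦ l ⟧ 0ᵛ) _) q) (subst (n + b ≤_) e r)) (≲-⊔ʳ l m)

  s^-s : ∀ n l → s^[ n ] s l ≡ s (s^[ n ] l)
  s^-s zero    l = refl
  s^-s (suc n) l = cong s (s^-s n l)

  s^-distrib-⊔ : ∀ n l m → s^[ n ] (l ⊔ m) ≃ s^[ n ] l ⊔ s^[ n ] m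
  s^-distrib-⊔ zero    l m = ≃-refl
  s^-distrib-⊔ (suc n) l m = ≃-trans (≃-s (s^-distrib-⊔ n l m)) (s-distrib-⊔ _ _)

  -- Induction on `l`, with `n` collecting the successors stripped so far. At a leaf a single
  -- valuation decides.
  ≤⇒s^≲ : ∀ n l m → (∀ x → n + ⟦ l ⟧ x ≤ ⟦ m ⟧ x) → s^[ n ] l ≲ m
  ≤⇒s^≲ n (var i) m h = ≤⇒s^var≲ n m (ℕ.m≤n+m b n)
    (subst (λ v → n + v ≤ ⟦ m ⟧ (spike i b)) (spike-eq i b) (h (spike i b)))
    -- One more than the value of `m` at zero, so that only a summand containing `i` can reach
    -- `n + b`.
    where b = suc (⟦ m ⟧ 0ᵛ)
  ≤⇒s^≲ n z m h = ≤⇒s^z≲ n m (subst (_≤ ⟦ m ⟧ 0ᵛ) (ℕ.+-identityʳ n) (h 0ᵛ))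
  ≤⇒s^≲ n (s l) m h = subst (_≲ m) (sym (s^-s n l))
    (≤⇒s^≲ (suc n) l m λ x → subst (_≤ ⟦ m ⟧ x) (ℕ.+-suc n (⟦ l ⟧ x)) (h x))
  ≤⇒s^≲ n (l ⊔ l′) m h = ≃-trans (≃-⊔ (s^-distrib-⊔ n l l′) ≃-refl) (≲-lub
    (≤⇒s^≲ n l m λ x → ℕ.≤-trans (ℕ.+-monoʳ-≤ n (ℕ.m≤m⊔n _ _)) (h x))
    (≤⇒s^≲ n l′ m λ x → ℕ.≤-trans (ℕ.+-monoʳ-≤ n (ℕ.m≤n⊔m (⟦ l ⟧ x) _)) (h x)))

  ≗⇒≃ : ∀ {l m} → ⟦ l ⟧ ≗ ⟦ m ⟧ → l ≃ m
  ≗⇒≃ {l} {m} e = ≲-antisym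
    (≤⇒s^≲ 0 l m (ℕ.≤-reflexive ∘ e))
    (≤⇒s^≲ 0 m l (ℕ.≤-reflexive ∘ sym ∘ e))

  -- Normal forms

  -- The value of a form is a maximum of the values of its summands. The general `P` serves
  -- non-strict bounds, strict bounds and bounds on `e + v` alike.
  form-closed : ∀ {q} (P : ℕ → Set q) → (∀ {m n} → P m → P n → P (m ℕ.⊔ n)) →
                ∀ k V {x} → P k → All (λ (i , n) → P (n + x i)) V → P (⟦ form k V ⟧ x)
  form-closed P P-⊔ k V {x} Pk PV = go V PV
    where
    Pk′ : P (⟦ s^[ k ] z ⟧ x)
    Pk′ = subst P (sym (trans (⟦⟧-s^ k z x) (ℕ.+-identityʳ k))) Pk
    ⨆-closed : ∀ v V → All (λ (i , n) → P (n + x i)) (v ∷ V) → P (⟦ ⨆ v V ⟧ x)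
    ⨆-closed (i , n) []      (q ∷ _)  = subst P (sym (⟦⟧-s^ n (var i) x)) q
    ⨆-closed (i , n) (v ∷ V) (q ∷ qs) = P-⊔ (subst P (sym (⟦⟧-s^ n (var i) x)) q) (⨆-closed v V qs)
    go : ∀ V → All (λ (i , n) → P (n + x i)) V → P (⟦ form k V ⟧ x)
    go []      _  = Pk′
    go (v ∷ V) qs = P-⊔ Pk′ (⨆-closed v V qs)

  -- Together with `const≤form` and `summand≤form` this makes the value of a form a least upper
  -- bound; forms are compared through these bounds below.
  form-lub : ∀ k V {x b} → k ≤ b → All (λ (i , n) → n + x i ≤ b) V → ⟦ form k V ⟧ x ≤ b
  form-lub k V {b = b} = form-closed (_≤ b) ℕ.⊔-lub k V

  const≤form : ∀ k V x → k ≤ ⟦ form k V ⟧ x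
  const≤form k V x = subst (_≤ ⟦ form k V ⟧ x) (trans (⟦⟧-s^ k z x) (ℕ.+-identityʳ k)) (go V)
    where
    go : ∀ V → ⟦ s^[ k ] z ⟧ x ≤ ⟦ form k V ⟧ x
    go []      = ℕ.≤-refl
    go (v ∷ V) = ℕ.m≤m⊔n _ _

  summand≤form : ∀ k V {i n} x → (i , n) ∈ V → n + x i ≤ ⟦ form k V ⟧ x
  summand≤form k (v ∷ V) {i} {n} x q = ℕ.≤-trans (go v V q) (ℕ.m≤n⊔m (⟦ s^[ k ] z ⟧ x) _)
    where
    go : ∀ v V → (i , n) ∈ v ∷ V → n + x i ≤ ⟦ ⨆ v V ⟧ x
    go v []      (here refl) = ℕ.≤-reflexive (sym (⟦⟧-s^ n (var i) x))
    go v (w ∷ V) (here refl) =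
      ℕ.≤-trans (ℕ.≤-reflexive (sym (⟦⟧-s^ n (var i) x))) (ℕ.m≤m⊔n _ _)
    go (j , m) (w ∷ V) (there q) = ℕ.≤-trans (go w V q) (ℕ.m≤n⊔m (⟦ s^[ m ] var j ⟧ x) _)

  vars-s^ : ∀ n l → vars (s^[ n ] l) ≡ vars l
  vars-s^ zero    l = refl
  vars-s^ (suc n) l = vars-s^ n l

  vars-form : ∀ k V → vars (form k V) ≡ map proj₁ V
  vars-form k []      = vars-s^ k z
  vars-form k (v ∷ V) = cong₂ _++_ (vars-s^ k z) (go v V)
    where
    go : ∀ v V → vars (⨆ v V) ≡ map proj₁ (v ∷ V)
    go (i , n) []      = vars-s^ n (var i)
    go (i , n) (w ∷ V) = cong₂ _++_ (vars-s^ n (var i)) (go w V)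

  -- `_SummandOf_` splits joins but not successors, so a bare variable can only be a summand of
  -- exponent 0.
  var-SummandOf-form : ∀ {i} k V → var i SummandOf form k V → (i , 0) ∈ V
  var-SummandOf-form {i} k V = form-case V
    where
    const-case : ∀ k → ¬ var i SummandOf (s^[ k ] z)
    const-case zero ()
    const-case (suc k) ()
    var-case : ∀ n j {V : Summands} → var i SummandOf (s^[ n ] var j) → (i , 0) ∈ (j , n) ∷ V
    var-case zero    j here = here refl
    var-case (suc n) j ()
    ⨆-case : ∀ v V → var i SummandOf ⨆ v V → (i , 0) ∈ v ∷ V
    ⨆-case (j , n) []      q         = var-case n j q
    ⨆-case (j , n) (w ∷ V) (left q)  = var-case n j q
    ⨆-case (j , n) (w ∷ V) (right q) = there (⨆-case w V q)
    form-case : ∀ V → var i SummandOf form k V → (i , 0) ∈ V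
    form-case []      q         = contradiction q (const-case k)
    form-case (v ∷ V) (left q)  = contradiction q (const-case k)
    form-case (v ∷ V) (right q) = ⨆-case v V q

  increasing⇒functional : ∀ (V : Summands) {i n n′} → StrictlyIncreasing (map proj₁ V) →
                          (i , n) ∈ V → (i , n′) ∈ V → n ≡ n′
  increasing⇒functional (v ∷ V) _        (here refl) (here refl) = refl
  increasing⇒functional (v ∷ V) (lt ∷ _) (here refl) (there q)   =
    contradiction (All.lookup lt (∈-map⁺ proj₁ q)) (irrefl refl)
  increasing⇒functional (v ∷ V) (lt ∷ _) (there q)   (here refl) =
    contradiction (All.lookup lt (∈-map⁺ proj₁ q)) (irrefl refl)
  increasing⇒functional (v ∷ V) (_ ∷ inc) (there q)  (there r)   =
    increasing⇒functional V inc q r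

  -- Dropping summands and lowering exponents

  dropSmaller⊆ : ∀ W V {v} → v ∈ dropSmaller W V → v ∈ V
  dropSmaller⊆ W V q = proj₁ (∈-filter⁻ _ {xs = V} q)

  kept⊎dropped : ∀ W V {i n} → (i , n) ∈ V →
                 (i , n) ∈ dropSmaller W V ⊎ (∃[ m ] (i , m) ∈ W × n ℕ.< m)
  kept⊎dropped W V {i} {n} q with any? (λ (j , m) → (i ≟ j) ×-dec (n ℕ.<? m)) W
  ... | no  ¬larger = inj₁ (∈-filter⁺ _ q ¬larger)
  ... | yes larger with find larger
  ...   | (_ , m) , r , refl , n<m = inj₂ (m , r , n<m)

  form-dropSmaller≤ : ∀ k W V x → ⟦ form k (dropSmaller W V) ⟧ x ≤ ⟦ form k V ⟧ x
  form-dropSmaller≤ k W V x = form-lub k (dropSmaller W V) (const≤form k V x)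
    (All.tabulate (summand≤form k V x ∘ dropSmaller⊆ W V))

  -- A dropped summand lies strictly below a summand of W, hence below the value
  -- of V, so it does not attain the maximum.
  form-dropSmaller : ∀ k W V x → (∀ {i m} → (i , m) ∈ W → m + x i ≤ ⟦ form k V ⟧ x) →
                     ⟦ form k (dropSmaller W V) ⟧ x ≡ ⟦ form k V ⟧ x
  form-dropSmaller k W V x W≤V =
    ℕ.≤-antisym (form-dropSmaller≤ k W V x) (ℕ.≮⇒≥ λ smaller → ℕ.<-irrefl refl
      (form-closed (ℕ._< ⟦ form k V ⟧ x) ℕ.⊔-lub k V
        (ℕ.≤-<-trans (const≤form k (dropSmaller W V) x) smaller)
        (All.tabulate λ q → case smaller (kept⊎dropped W V q))))
    where
    case : ⟦ form k (dropSmaller W V) ⟧ x ℕ.< ⟦ form k V ⟧ x → ∀ {i n} →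
           (i , n) ∈ dropSmaller W V ⊎ (∃[ m ] (i , m) ∈ W × n ℕ.< m) →
           n + x i ℕ.< ⟦ form k V ⟧ x
    case smaller (inj₁ kept) = ℕ.≤-<-trans (summand≤form k _ x kept) smaller
    case _ {i} (inj₂ (m , r , n<m)) = ℕ.<-≤-trans (ℕ.+-monoˡ-< (x i) n<m) (W≤V r)

  -- A summand dropped from `V` lies below a summand of `W` with the same variable. The latter is
  -- kept, since otherwise `V` would hold that variable with two exponents, so the equation bounds
  -- it by the reduced `V`.
  form-undrop : ∀ k k′ V W x → StrictlyIncreasing (map proj₁ V) →
                ⟦ form k (dropSmaller W V) ⟧ x ≡ ⟦ form k′ (dropSmaller V W) ⟧ x →
                ⟦ form k V ⟧ x ≡ ⟦ form k (dropSmaller W V) ⟧ x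
  form-undrop k k′ V W x inc e = ℕ.≤-antisym
    (form-lub k V (const≤form k (dropSmaller W V) x) (All.tabulate bound))
    (form-dropSmaller≤ k W V x)
    where
    bound : ∀ {v} → v ∈ V → proj₂ v + x (proj₁ v) ≤ ⟦ form k (dropSmaller W V) ⟧ x
    bound {i , n} q with kept⊎dropped W V q
    ... | inj₁ kept = summand≤form k _ x kept
    ... | inj₂ (m , r , n<m) with kept⊎dropped V W r
    ...   | inj₁ kept = ℕ.≤-trans (ℕ.+-monoˡ-≤ (x i) (ℕ.<⇒≤ n<m))
                          (ℕ.≤-trans (summand≤form k′ _ x kept) (ℕ.≤-reflexive (sym e)))
    ...   | inj₂ (n′ , q′ , m<n′) = contradiction
              (subst (m ℕ.<_) (sym (increasing⇒functional V inc q q′)) m<n′) (ℕ.<-asym n<m)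

  -- As `e` is at most every exponent, the truncated subtractions are exact, and adding `e`
  -- distributes over the maximum.
  form-lower : ∀ e k V x → e ≤ k → All (λ (_ , n) → e ≤ n) V →
               e + ⟦ form (k ∸ e) (lower e V) ⟧ x ≡ ⟦ form k V ⟧ x
  form-lower e k V x e≤k e≤V = ℕ.≤-antisym
    (form-closed (λ v → e + v ≤ ⟦ form k V ⟧ x)
      (λ {m} {n} q r → subst (_≤ ⟦ form k V ⟧ x) (sym (ℕ.+-distribˡ-⊔ e m n)) (ℕ.⊔-lub q r))
      (k ∸ e) (lower e V)
      (subst (_≤ ⟦ form k V ⟧ x) (sym (ℕ.m+[n∸m]≡n e≤k)) (const≤form k V x))
      (map⁺ (All.tabulate λ { {i , n} q → subst (_≤ ⟦ form k V ⟧ x)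
        (trans (cong (_+ x i) (sym (ℕ.m+[n∸m]≡n (All.lookup e≤V q)))) (ℕ.+-assoc e (n ∸ e) (x i)))
        (summand≤form k V x q) })))
    (form-lub k V
      (ℕ.≤-trans (ℕ.m≤n+m∸n k e) (ℕ.+-monoʳ-≤ e (const≤form (k ∸ e) (lower e V) x)))
      (All.tabulate λ { {i , n} q → ℕ.≤-trans (ℕ.+-monoˡ-≤ (x i) (ℕ.m≤n+m∸n n e))
        (ℕ.≤-trans (ℕ.≤-reflexive (ℕ.+-assoc e (n ∸ e) (x i)))
          (ℕ.+-monoʳ-≤ e (summand≤form (k ∸ e) (lower e V) x (∈-map⁺ _ q)))) }))

  foldr-⊓-≤ : ∀ c ns → All (foldr _⊓_ c ns ≤_) ns
  foldr-⊓-≤ c []       = []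
  foldr-⊓-≤ c (n ∷ ns) = ℕ.m⊓n≤m n _ ∷ All.map (ℕ.≤-trans (ℕ.m⊓n≤n n _)) (foldr-⊓-≤ c ns)

  -- Normalization preserves solutions, normality and absence of variables

  Normal : Level → Set _
  Normal l = ∃[ N ] l ≡ level N

  Normalᶜ : Constraint → Set _
  Normalᶜ (l , m) = Normal l × Normal m

  Solves : Valuation → Constraint → Set
  Solves x (l , m) = ⟦ l ⟧ x ≡ ⟦ m ⟧ x

  _∉ᶜ_ : 𝓘 → Constraint → Set a
  j ∉ᶜ (l , m) = j ∉ vars l × j ∉ vars m

  lower-vars : ∀ e V → map proj₁ (lower e V) ≡ map proj₁ V
  lower-vars e V = sym (map-∘ V)

  -- Shows that each side of a normalized constraint is again a normal form, as the invariant of a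
  -- run demands.
  dropLower : ℕ → Summands → NormalForm → NormalForm
  dropLower e W N = record
    { const      = const N ∸ e
    ; summands   = lower e (dropSmaller W (summands N))
    ; increasing = subst StrictlyIncreasing (sym (lower-vars e _))
        (AllPairs.map⁺ (AllPairs.filter⁺ _ (AllPairs.map⁻ (increasing N))))
    ; bounded    = map⁺ (All.map (ℕ.∸-monoˡ-≤ e) (anti-mono (dropSmaller⊆ W (summands N)) (bounded N)))
    }

  dropLower-∉ : ∀ e W N {j} → j ∉ vars (level N) → j ∉ vars (level (dropLower e W N))
  dropLower-∉ e W N {j} j∉ j∈
    with v , q , refl ← ∈-map⁻ proj₁ (subst (j ∈_) (trans (vars-form (const N ∸ e) _) (lower-vars e _)) j∈)
    = j∉ (subst (j ∈_) (sym (vars-form (const N) (summands N))) (∈-map⁺ proj₁ (dropSmaller⊆ W (summands N) q)))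

  module _ (N M : NormalForm) where

    private
      kN kM e : ℕ
      kN = const N
      kM = const M
      V W : Summands
      V = dropSmaller (summands M) (summands N)
      W = dropSmaller (summands N) (summands M)
      e = foldr _⊓_ kN (exponents kN V ++ exponents kM W)

      e≤ : All (e ≤_) (exponents kN V) × All (e ≤_) (exponents kM W)
      e≤ = ++⁻ (exponents kN V) (foldr-⊓-≤ kN (exponents kN V ++ exponents kM W))

      eqN : ∀ x → e + ⟦ form (kN ∸ e) (lower e V) ⟧ x ≡ ⟦ form kN V ⟧ x
      eqN x = form-lower e kN V x (All.head (proj₁ e≤)) (map⁻ (All.tail (proj₁ e≤)))

      eqM : ∀ x → e + ⟦ form (kM ∸ e) (lower e W) ⟧ x ≡ ⟦ form kM W ⟧ x
      eqM x = form-lower e kM W x (All.head (proj₂ e≤)) (map⁻ (All.tail (proj₂ e≤)))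

    -- At a solution each summand of one side is bounded by the value of the other, so dropping is
    -- harmless on both sides. The common `e` then cancels.
    normalize-solves⁺ : ∀ {x} → Solves x (level N , level M) → Solves x (normalize N M)
    normalize-solves⁺ {x} eq = ℕ.+-cancelˡ-≡ e _ _ $ begin
      e + ⟦ form (kN ∸ e) (lower e V) ⟧ x ≡⟨ eqN x ⟩
      ⟦ form kN V ⟧ x                     ≡⟨ form-dropSmaller kN _ (summands N) x
                                              (λ q → subst (_ ≤_) (sym eq) (summand≤form kM (summands M) x q)) ⟩
      ⟦ level N ⟧ x                       ≡⟨ eq ⟩
      ⟦ level M ⟧ x                       ≡⟨ form-dropSmaller kM _ (summands M) x
                                              (λ q → subst (_ ≤_) eq (summand≤form kN (summands N) x q)) ⟨
      ⟦ form kM W ⟧ x                     ≡⟨ eqM x ⟨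
      e + ⟦ form (kM ∸ e) (lower e W) ⟧ x ∎
      where open ≡-Reasoning

    -- Here only the reduced sides are known to agree, so the dropped summands are restored by
    -- `form-undrop`.
    normalize-solves⁻ : ∀ {x} → Solves x (normalize N M) → Solves x (level N , level M)
    normalize-solves⁻ {x} eq = begin
      ⟦ level N ⟧ x   ≡⟨ form-undrop kN kM (summands N) (summands M) x (increasing N) eq′ ⟩
      ⟦ form kN V ⟧ x ≡⟨ eq′ ⟩
      ⟦ form kM W ⟧ x ≡⟨ form-undrop kM kN (summands M) (summands N) x (increasing M) (sym eq′) ⟨
      ⟦ level M ⟧ x   ∎
      where
      open ≡-Reasoning
      eq′ : ⟦ form kN V ⟧ x ≡ ⟦ form kM W ⟧ x
      eq′ = trans (sym (eqN x)) (trans (cong (e +_) eq) (eqM x))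

    normalize-normal : Normalᶜ (normalize N M)
    normalize-normal = (dropLower e (summands M) N , refl) , (dropLower e (summands N) M , refl)

    normalize-∉ : ∀ {j} → j ∉ᶜ (level N , level M) → j ∉ᶜ normalize N M
    normalize-∉ (j∉N , j∉M) = dropLower-∉ e (summands M) N j∉N , dropLower-∉ e (summands N) M j∉M

  hat-normal : ∀ {ĉ c} → ĉ IsHatOf c → Normalᶜ ĉ
  hat-normal (N , M , _ , _ , refl) = normalize-normal N M

  hat-∉ : ∀ {ĉ c j} → ĉ IsHatOf c → j ∉ᶜ c → j ∉ᶜ ĉ
  hat-∉ (N , M , (_ , N≃l) , (_ , M≃m) , refl) (j∉l , j∉m) =
    normalize-∉ N M (j∉l ∘ proj₁ (≃-vars N≃l) , j∉m ∘ proj₁ (≃-vars M≃m))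

  hat-solves⁺ : ∀ {ĉ c x} → ĉ IsHatOf c → Solves x c → Solves x ĉ
  hat-solves⁺ {x = x} (N , M , (_ , N≃l) , (_ , M≃m) , refl) e =
    normalize-solves⁺ N M {x} (trans (≃⇒≗ N≃l x) (trans e (sym (≃⇒≗ M≃m x))))

  hat-solves⁻ : ∀ {ĉ c x} → ĉ IsHatOf c → Solves x ĉ → Solves x c
  hat-solves⁻ {x = x} (N , M , (_ , N≃l) , (_ , M≃m) , refl) e =
    trans (sym (≃⇒≗ N≃l x)) (trans (normalize-solves⁻ N M {x} e) (≃⇒≗ M≃m x))

  hatˢ-≃ : ∀ {θ̂ θ} → θ̂ IsHatOfˢ θ → ∀ i → θ̂ i ≃ θ i
  hatˢ-≃ {θ̂} {θ} hat i with Dom? θ i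
  ... | yes d = proj₂ (proj₁ (hat i) d)
  ... | no ¬d = subst₂ _≃_ (sym (proj₂ (hat i) ¬d)) (sym (¬Dom⇒var θ ¬d)) ≃-refl

  -- Invariants and solutions of the states of a run

  hatᶜ-normal : ∀ {Ĉ C} → Ĉ IsHatOfᶜ C → All Normalᶜ Ĉ
  hatᶜ-normal []           = []
  hatᶜ-normal (hat ∷ hats) = hat-normal hat ∷ hatᶜ-normal hats

  hatᶜ-∉ : ∀ {Ĉ C j} → Ĉ IsHatOfᶜ C → All (j ∉ᶜ_) C → All (j ∉ᶜ_) Ĉ
  hatᶜ-∉ []           []       = []
  hatᶜ-∉ (hat ∷ hats) (q ∷ qs) = hat-∉ hat q ∷ hatᶜ-∉ hats qs

  hatᶜ-solves⁺ : ∀ {Ĉ C x} → Ĉ IsHatOfᶜ C → All (Solves x) C → All (Solves x) Ĉ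
  hatᶜ-solves⁺ []           []       = []
  hatᶜ-solves⁺ {x = x} (hat ∷ hats) (q ∷ qs) = hat-solves⁺ {x = x} hat q ∷ hatᶜ-solves⁺ hats qs

  hatᶜ-solves⁻ : ∀ {Ĉ C x} → Ĉ IsHatOfᶜ C → All (Solves x) Ĉ → All (Solves x) C
  hatᶜ-solves⁻ []           []       = []
  hatᶜ-solves⁻ {x = x} (hat ∷ hats) (q ∷ qs) = hat-solves⁻ {x = x} hat q ∷ hatᶜ-solves⁻ hats qs

  ∉varsᶜ : ∀ C {j} → j ∉ varsᶜ C → All (j ∉ᶜ_) C
  ∉varsᶜ []            j∉ = []
  ∉varsᶜ ((l , m) ∷ C) j∉ =
    (j∉ ∘ ∈-++⁺ˡ ∘ ∈-++⁺ˡ , j∉ ∘ ∈-++⁺ˡ ∘ ∈-++⁺ʳ (vars l)) ∷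
    ∉varsᶜ C (j∉ ∘ ∈-++⁺ʳ (vars l ++ vars m))

  All-≈∪⁺ : ∀ {q} {P : Constraint → Set q} {C₀ c C} → C₀ ≈ c ∪ C → All P C₀ → P c × All P C
  All-≈∪⁺ eq = All.uncons ∘ anti-mono (Equivalence.from eq)

  All-≈∪⁻ : ∀ {q} {P : Constraint → Set q} {C₀ c C} → C₀ ≈ c ∪ C → All P (c ∷ C) → All P C₀
  All-≈∪⁻ eq = anti-mono (Equivalence.to eq)

  -- `normal` lets `unrename` read off the summands of a side, `dom-∉ᶜ` keeps the variable about to
  -- be eliminated out of the domain, and `dom-∉` makes the final substitution idempotent.
  record Invariant (C : Constraints) (θ : Subst) : Set (a Universe.⊔ ℓ) where
    field
      normal : All Normalᶜ C
      dom-∉ᶜ : ∀ {j} → Dom θ j → All (j ∉ᶜ_) C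
      dom-∉  : ∀ {j} → Dom θ j → ∀ k → j ∉ vars (θ k)

  open Invariant

  infix 4 _⊩_︔_
  record _⊩_︔_ (x : Valuation) (C : Constraints) (θ : Subst) : Set a where
    constructor _,_
    field
      solves : All (Solves x) C
      fixed  : ∀ j → x j ≡ ⟦ θ j ⟧ x

  open _⊩_︔_

  -- The elimination of a variable, common to both rules

  module Elimination {C C′} θ {θ′ i l}
    (hatᶜ : C′ IsHatOfᶜ substᶜ (l / i) C)
    (hatˢ : θ′ IsHatOfˢ substˢ (l / i) θ)
    where

    Dom-↦ : ∀ {j} → Dom (θ′ , i ↦ l) j → j ≡ i ⊎ Dom θ j
    Dom-↦ {j} d with j ≟ i
    ... | yes j≡i = inj₁ j≡i
    ... | no  _   with Dom? θ j
    ...   | yes d′ = inj₂ d′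
    ...   | no ¬d′ = contradiction
            (proj₂ (hatˢ j) λ d″ → d″ (substˢ-¬Dom (l / i) θ (¬Dom⇒var θ ¬d′))) d

    -- The domain gains at most `i`. The replacement removes `i` and introduces only variables of
    -- `l`, among which are neither `i` nor members of the old domain.
    invariant : Invariant C θ → i ∉ vars l → (∀ {j} → Dom θ j → j ∉ vars l) →
                Invariant C′ (θ′ , i ↦ l)
    invariant inv i∉l dom∉l = record
      { normal = hatᶜ-normal hatᶜ
      ; dom-∉ᶜ = λ d → constraints-∉ (Dom-↦ d)
      ; dom-∉  = λ d → substitution-∉ (Dom-↦ d)
      }
      where
      l-∉ : ∀ {j} → j ≡ i ⊎ Dom θ j → j ∉ vars l
      l-∉ (inj₁ refl) = i∉l
      l-∉ (inj₂ d)    = dom∉l d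

      constraints-∉ : ∀ {j} → j ≡ i ⊎ Dom θ j → All (j ∉ᶜ_) C′
      constraints-∉ e@(inj₁ j≡i) = hatᶜ-∉ hatᶜ (map⁺ (All.universal (λ (m , n) →
        vars-/ m l (l-∉ e) (inj₁ j≡i) , vars-/ n l (l-∉ e) (inj₁ j≡i)) C))
      constraints-∉ e@(inj₂ d) = hatᶜ-∉ hatᶜ (map⁺ (All.map (λ {(m , n)} (j∉m , j∉n) →
        vars-/ m l (l-∉ e) (inj₂ j∉m) , vars-/ n l (l-∉ e) (inj₂ j∉n)) (dom-∉ᶜ inv d)))

      substˢ-∉ : ∀ {j} → j ≡ i ⊎ Dom θ j → ∀ k → k ≢ i → j ∉ vars (substˢ (l / i) θ k)
      substˢ-∉ {j} e k k≢i j∈ with Dom? θ k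
      ... | yes d = vars-/ (θ k) l (l-∉ e) ([ inj₁ , (λ d′ → inj₂ (dom-∉ inv d′ k)) ]′ e)
                      (subst (λ m → j ∈ vars m) (substˢ-Dom (l / i) θ d) j∈)
      -- Outside the domain `k` stays a variable, which differs from `i` and from every member of
      -- the domain.
      ... | no ¬d with subst (λ m → j ∈ vars m) (substˢ-¬Dom (l / i) θ (¬Dom⇒var θ ¬d)) j∈
      ...   | here refl = [ k≢i , ¬d ]′ e

      substitution-∉ : ∀ {j} → j ≡ i ⊎ Dom θ j → ∀ k → j ∉ vars ((θ′ , i ↦ l) k)
      substitution-∉ e k j∈ with k ≟ i
      ... | yes _  = l-∉ e j∈
      ... | no k≢i = substˢ-∉ e k k≢i (proj₁ (≃-vars (hatˢ-≃ hatˢ k)) j∈)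

    ⟦θ′⟧ : ∀ {x} → x i ≡ ⟦ l ⟧ x → ∀ j → ⟦ θ′ j ⟧ x ≡ ⟦ θ j ⟧ x
    ⟦θ′⟧ {x} xi j with Dom? θ j
    ... | yes d = trans (≃⇒≗ (hatˢ-≃ hatˢ j) x)
                    (trans (cong (flip ⟦_⟧ x) (substˢ-Dom (l / i) θ d)) (⟦⟧-/ (θ j) l xi))
    ... | no ¬d = trans (≃⇒≗ (hatˢ-≃ hatˢ j) x)
                    (cong (flip ⟦_⟧ x) (trans (substˢ-¬Dom (l / i) θ (¬Dom⇒var θ ¬d)) (sym (¬Dom⇒var θ ¬d))))

    ⊩⁺ : ∀ {x} → x i ≡ ⟦ l ⟧ x → x ⊩ C ︔ θ → x ⊩ C′ ︔ (θ′ , i ↦ l)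
    ⊩⁺ {x} xi (x⊩C , x⊩θ) =
      hatᶜ-solves⁺ hatᶜ (map⁺ (All.map (λ {(m , n)} e →
        trans (⟦⟧-/ m l xi) (trans e (sym (⟦⟧-/ n l xi)))) x⊩C)) , fixed′
      where
      fixed′ : ∀ j → x j ≡ ⟦ (θ′ , i ↦ l) j ⟧ x
      fixed′ j with j ≟ i
      ... | yes refl = xi
      ... | no  _    = trans (x⊩θ j) (sym (⟦θ′⟧ xi j))

    ⊩⇒eliminated : ∀ {x} → x ⊩ C′ ︔ (θ′ , i ↦ l) → x i ≡ ⟦ l ⟧ x
    ⊩⇒eliminated {x} x⊩ = trans (fixed x⊩ i) (cong (flip ⟦_⟧ x) (↦-eq θ′ i l))

    ⊩⁻ : ∀ {x} → ¬ Dom θ i → x ⊩ C′ ︔ (θ′ , i ↦ l) → x ⊩ C ︔ θ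
    ⊩⁻ {x} i∉dom x⊩@(x⊩C′ , x⊩θ′) =
      All.map (λ {(m , n)} e → trans (sym (⟦⟧-/ m l xi)) (trans e (⟦⟧-/ n l xi)))
        (map⁻ (hatᶜ-solves⁻ hatᶜ x⊩C′)) , fixed′
      where
      xi : x i ≡ ⟦ l ⟧ x
      xi = ⊩⇒eliminated x⊩
      fixed′ : ∀ j → x j ≡ ⟦ θ j ⟧ x
      fixed′ j with j ≟ i
      -- The new binding hides the old image of `i`. That image was `var i`, so its equation is
      -- trivial.
      ... | yes refl = sym (cong (flip ⟦_⟧ x) (¬Dom⇒var θ i∉dom))
      ... | no  j≢i  = trans (x⊩θ′ j) (trans (cong (flip ⟦_⟧ x) (↦-neq θ′ l j≢i)) (⟦θ′⟧ xi j))

  -- Since i occurs in l only with exponent 0, the constraint i = l just says that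
  -- i bounds the other summands of l, and these also occur in l{i′/i}.
  unrename : ∀ {i i′ l x} → Normal l → var i SummandOf l →
             x i ≡ ⟦ l [ var i′ / i ] ⟧ x → x i ≡ ⟦ l ⟧ x
  unrename {i} {i′} {x = x} (N , refl) i∈l xi = ℕ.≤-antisym
    (summand≤form (const N) (summands N) x i,0∈)
    (form-lub (const N) (summands N) const≤ (All.tabulate summand≤))
    where
    i,0∈ : (i , 0) ∈ summands N
    i,0∈ = var-SummandOf-form (const N) (summands N) i∈l

    y : Valuation
    -- `y` reads `i` as `i′`, so that the renamed level at `x` is the original level at `y`.
    y j = ⟦ (var i′ / i) j ⟧ x

    xi′ : ⟦ level N ⟧ y ≡ x i
    xi′ = trans (sym (⟦⟧-subst (level N) (var i′ / i) x)) (sym xi)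

    const≤ : const N ≤ x i
    const≤ = subst (const N ≤_) xi′ (const≤form (const N) (summands N) y)

    summand≤ : ∀ {v} → v ∈ summands N → proj₂ v + x (proj₁ v) ≤ x i
    summand≤ {j , n} q with j ≟ i
    -- Exponents are unique, so this summand is `i` itself with exponent 0.
    ... | yes refl = ℕ.≤-reflexive
            (cong (_+ x i) (increasing⇒functional (summands N) (increasing N) q i,0∈))
    ... | no  j≢i  = subst₂ _≤_ (cong (λ m → n + ⟦ m ⟧ x) (↦-neq id (var i′) j≢i)) xi′
            (summand≤form (const N) (summands N) y q)

  z-normal : Normal z
  z-normal = record { const = 0 ; summands = [] ; increasing = [] ; bounded = [] } , refl

  z⊔var-normal : ∀ i → Normal (z ⊔ var i)
  z⊔var-normal i =
    record { const = 0 ; summands = (i , 0) ∷ [] ; increasing = [] ∷ [] ; bounded = z≤n ∷ [] } , refl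

  -- Steps and runs preserve solutions

  record Preserves (C₀ : Constraints) (θ₀ : Subst) (C₁ : Constraints) (θ₁ : Subst)
         : Set (a Universe.⊔ ℓ Universe.⊔ p) where
    field
      invariant  : Invariant C₁ θ₁
      backward   : ∀ {x} → x ⊩ C₁ ︔ θ₁ → x ⊩ C₀ ︔ θ₀
      -- Elimination with a fresh variable i′ extends a solution by i′ ↦ i.
      rename     : 𝓘 → 𝓘
      rename-old : ∀ {j} → ¬ Fresh j → rename j ≡ j
      forward    : ∀ {x} → x ⊩ C₀ ︔ θ₀ → (x ∘ rename) ⊩ C₁ ︔ θ₁

  open Preserves

  -- Serves the steps that leave the substitution alone: trivial, orient and decompose.
  constraints-step : ∀ {C₀ C₁ θ} → Invariant C₀ θ →
                     All Normalᶜ C₁ → (∀ {j} → All (j ∉ᶜ_) C₀ → All (j ∉ᶜ_) C₁) →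
                     (∀ {x} → All (Solves x) C₁ → All (Solves x) C₀) →
                     (∀ {x} → All (Solves x) C₀ → All (Solves x) C₁) →
                     Preserves C₀ θ C₁ θ
  constraints-step inv nf ∉ᶜ⁺ back forth = record
    { invariant    = record { normal = nf ; dom-∉ᶜ = ∉ᶜ⁺ ∘ dom-∉ᶜ inv ; dom-∉ = dom-∉ inv }
    ; backward     = λ (x⊩C , x⊩θ) → back x⊩C , x⊩θ
    ; rename       = λ j → j
    ; rename-old   = λ _ → refl
    ; forward      = λ (x⊩C , x⊩θ) → forth x⊩C , x⊩θ
    }

  eliminate₁-preserves : ∀ {C₀ C C′ θ θ′ i l} → Invariant C₀ θ → C₀ ≈ (z ⊔ var i , l) ∪ C →
    i ∉ vars l → C′ IsHatOfᶜ substᶜ (l / i) C → θ′ IsHatOfˢ substˢ (l / i) θ →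
    Preserves C₀ θ C′ (θ′ , i ↦ l)
  eliminate₁-preserves {C₀} {C} {C′} {θ} {θ′} {i} {l} inv eq i∉l hatᶜ hatˢ = record
    { invariant    = E.invariant
        (record { normal = proj₂ (All-≈∪⁺ eq (normal inv))
                ; dom-∉ᶜ = proj₂ ∘ All-≈∪⁺ eq ∘ dom-∉ᶜ inv ; dom-∉ = dom-∉ inv })
        i∉l (λ d → proj₂ (proj₁ (All-≈∪⁺ eq (dom-∉ᶜ inv d))))
    ; backward     = λ x⊩ → let x⊩C , x⊩θ = E.⊩⁻ i∉dom x⊩ in
                     All-≈∪⁻ eq (E.⊩⇒eliminated x⊩ ∷ x⊩C) , x⊩θ
    ; rename       = λ j → j
    ; rename-old   = λ _ → refl
    -- `xi` is the constraint itself, as `z ⊔ var i` evaluates to `x i` by computation.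
    ; forward      = λ (x⊩C , x⊩θ) → let xi , x⊩C′ = All-≈∪⁺ eq x⊩C in E.⊩⁺ xi (x⊩C′ , x⊩θ)
    }
    where
    module E = Elimination θ hatᶜ hatˢ
    i∉dom : ¬ Dom θ i
    i∉dom d = proj₁ (proj₁ (All-≈∪⁺ eq (dom-∉ᶜ inv d))) (here refl)

  -- Forward, `r` sends `i′` to `i`, which turns the equation for `l` into one for `l′`. As `i′`
  -- occurs in none of `l`, `C` and `θ`, nothing else is disturbed. Backward, `unrename` recovers
  -- the constraint.
  eliminate₂-preserves : ∀ {C₀ C C′ θ θ′ i i′ l} → Invariant C₀ θ → C₀ ≈ (z ⊔ var i , l) ∪ C →
    var i SummandOf l → Fresh i′ → i′ ∉ i ∷ vars l ++ varsᶜ C → ¬ Varsˢ θ i′ →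
    let l′ = l [ var i′ / i ] in
    C′ IsHatOfᶜ substᶜ (l′ / i) C → θ′ IsHatOfˢ substˢ (l′ / i) θ →
    Preserves C₀ θ C′ (θ′ , i ↦ l′)
  eliminate₂-preserves {C₀} {C} {C′} {θ} {θ′} {i} {i′} {l} inv eq i∈l fresh i′∉ i′∉θ hatᶜ hatˢ = record
    { invariant    = E.invariant
        (record { normal = proj₂ (All-≈∪⁺ eq (normal inv))
                ; dom-∉ᶜ = proj₂ ∘ All-≈∪⁺ eq ∘ dom-∉ᶜ inv ; dom-∉ = dom-∉ inv })
        (vars-/ l (var i′) (λ { (here refl) → i′≢i refl }) (inj₁ refl))
        (λ d → vars-/ l (var i′) (λ { (here refl) → i′∉θ (inj₁ d) })
          (inj₂ (proj₂ (proj₁ (All-≈∪⁺ eq (dom-∉ᶜ inv d))))))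
    ; backward     = λ x⊩ → let x⊩C , x⊩θ = E.⊩⁻ i∉dom x⊩ in
        All-≈∪⁻ eq (unrename (proj₂ (proj₁ (All-≈∪⁺ eq (normal inv)))) i∈l (E.⊩⇒eliminated x⊩) ∷ x⊩C) , x⊩θ
    ; rename       = r
    ; rename-old   = λ old → r-neq λ { refl → old fresh }
    ; forward      = λ (x⊩C , x⊩θ) → let xi , x⊩C′ = All-≈∪⁺ eq x⊩C in
        E.⊩⁺ (r-xi xi) (r-solves x⊩C′ , r-fixed x⊩θ)
    }
    where
    l′ : Level
    l′ = l [ var i′ / i ]

    module E = Elimination θ hatᶜ hatˢ

    i′≢i : i′ ≢ i
    i′≢i = i′∉ ∘ here

    i′∉l : i′ ∉ vars l
    i′∉l = i′∉ ∘ there ∘ ∈-++⁺ˡ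

    i′∉C : All (i′ ∉ᶜ_) C
    i′∉C = ∉varsᶜ C (i′∉ ∘ there ∘ ∈-++⁺ʳ (vars l))

    i∉dom : ¬ Dom θ i
    i∉dom d = proj₁ (proj₁ (All-≈∪⁺ eq (dom-∉ᶜ inv d))) (here refl)

    r : 𝓘 → 𝓘
    r j with j ≟ i′
    ... | yes _ = i
    ... | no  _ = j

    r-eq : r i′ ≡ i
    r-eq with i′ ≟ i′
    ... | yes _     = refl
    ... | no  i′≢i′ = contradiction refl i′≢i′

    r-neq : ∀ {j} → j ≢ i′ → r j ≡ j
    r-neq {j} j≢i′ with j ≟ i′
    ... | yes j≡i′ = contradiction j≡i′ j≢i′
    ... | no  _    = refl

    ⟦⟧-r : ∀ m x → i′ ∉ vars m → ⟦ m ⟧ (x ∘ r) ≡ ⟦ m ⟧ x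
    ⟦⟧-r m x i′∉m = ⟦⟧-cong m λ j j∈ → cong x (r-neq λ { refl → i′∉m j∈ })

    r-xi : ∀ {x} → x i ≡ ⟦ l ⟧ x → x (r i) ≡ ⟦ l′ ⟧ (x ∘ r)
    r-xi {x} xi = begin
      x (r i)                              ≡⟨ cong x (r-neq (i′≢i ∘ sym)) ⟩
      x i                                  ≡⟨ xi ⟩
      ⟦ l ⟧ x                              ≡⟨ ⟦⟧-r l x i′∉l ⟨
      ⟦ l ⟧ (x ∘ r)                        ≡⟨ ⟦⟧-/ l (var i′) (cong x (trans (r-neq (i′≢i ∘ sym)) (sym r-eq))) ⟨
      ⟦ l′ ⟧ (x ∘ r)                       ∎
      where open ≡-Reasoning

    r-solves : ∀ {x} → All (Solves x) C → All (Solves (x ∘ r)) C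
    r-solves {x} qs = All.zipWith (λ {(m , n)} (e , i′∉m , i′∉n) →
      trans (⟦⟧-r m x i′∉m) (trans e (sym (⟦⟧-r n x i′∉n)))) (qs , i′∉C)

    r-fixed : ∀ {x} → (∀ j → x j ≡ ⟦ θ j ⟧ x) → ∀ j → x (r j) ≡ ⟦ θ j ⟧ (x ∘ r)
    r-fixed {x} x⊩θ j with Dom? θ j
    -- This includes `i′`, whose value does change; outside the domain the equation holds for any
    -- valuation.
    ... | no ¬d = sym (cong (flip ⟦_⟧ (x ∘ r)) (¬Dom⇒var θ ¬d))
    ... | yes d = trans (cong x (r-neq λ { refl → i′∉θ (inj₁ d) }))
                    (trans (x⊩θ j) (sym (⟦⟧-r (θ j) x λ i′∈ → i′∉θ (inj₂ (j , d , i′∈)))))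

  -- A maximum of natural numbers is 0 exactly when each of them is.
  decompose-preserves : ∀ {C₀ C θ} V → Invariant C₀ θ → C₀ ≈ (z , form 0 (map (_, 0) V)) ∪ C →
                        Preserves C₀ θ (map (λ i → z ⊔ var i , z) V ++ C) θ
  decompose-preserves V inv eq = constraints-step inv
    (++⁺ (map⁺ (All.universal (λ i → z⊔var-normal i , z-normal) V)) (proj₂ (All-≈∪⁺ eq (normal inv))))
    (λ {j} qs → let (_ , j∉V) , qs′ = All-≈∪⁺ eq qs in
      ++⁺ (map⁺ (All.tabulate λ {i} i∈V → (λ { (here refl) → j∉V (∈form i∈V) }) , λ ())) qs′)
    (λ {x} qs → let q , qs′ = ++⁻ (map (λ i → z ⊔ var i , z) V) qs in
      All-≈∪⁻ eq (sym (ℕ.n≤0⇒n≡0 (form-lub 0 (map (_, 0) V) z≤n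
        (map⁺ (All.map ℕ.≤-reflexive (map⁻ q))))) ∷ qs′))
    (λ {x} qs → let q , qs′ = All-≈∪⁺ eq qs in
      ++⁺ (map⁺ (All.tabulate λ {i} i∈V → ℕ.n≤0⇒n≡0
        (subst (x i ≤_) (sym q) (summand≤form 0 (map (_, 0) V) x (∈-map⁺ (_, 0) i∈V))))) qs′)
    where
    ∈form : ∀ {i} → i ∈ V → i ∈ vars (form 0 (map (_, 0) V))
    ∈form {i} i∈V = subst (i ∈_) (sym (vars-form 0 (map (_, 0) V)))
      (∈-map⁺ proj₁ (∈-map⁺ (_, 0) i∈V))

  step-preserves : ∀ {C₀ θ₀ C₁ θ₁} → Invariant C₀ θ₀ → (C₀ ︔ θ₀) ⇝ (C₁ ︔ θ₁) → Preserves C₀ θ₀ C₁ θ₁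
  step-preserves inv (trivial eq) = constraints-step inv
    (proj₂ (All-≈∪⁺ eq (normal inv)))
    (proj₂ ∘ All-≈∪⁺ eq)
    (λ qs → All-≈∪⁻ eq (refl ∷ qs))
    (proj₂ ∘ All-≈∪⁺ eq)
  step-preserves inv (orient eq _) = constraints-step inv
    (let (nl , nl′) , ns = All-≈∪⁺ eq (normal inv) in (nl′ , nl) ∷ ns)
    (λ qs → let (j∉l , j∉l′) , qs′ = All-≈∪⁺ eq qs in (j∉l′ , j∉l) ∷ qs′)
    (λ { (q ∷ qs) → All-≈∪⁻ eq (sym q ∷ qs) })
    (λ qs → let q , qs′ = All-≈∪⁺ eq qs in sym q ∷ qs′)
  step-preserves inv (eliminate₁ eq i∉l hatᶜ hatˢ) = eliminate₁-preserves inv eq i∉l hatᶜ hatˢ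
  step-preserves inv (eliminate₂ eq i∈l fresh i′∉ i′∉θ hatᶜ hatˢ) =
    eliminate₂-preserves inv eq i∈l fresh i′∉ i′∉θ hatᶜ hatˢ
  step-preserves inv (decompose V _ eq) = decompose-preserves V inv eq

  run-preserves : ∀ {C₀ θ₀ C₁ θ₁} → Invariant C₀ θ₀ → (C₀ ︔ θ₀) ⇝* (C₁ ︔ θ₁) → Preserves C₀ θ₀ C₁ θ₁
  run-preserves inv ε = record
    { invariant = inv ; backward = λ x⊩ → x⊩ ; rename = λ j → j
    ; rename-old = λ _ → refl ; forward = λ x⊩ → x⊩ }
  -- No step leaves `clash`, so a run through it cannot end in constraints.
  run-preserves inv (_◅_ {j = clash} _ (() ◅ _))
  run-preserves inv (_◅_ {j = _ ︔ _} step steps) = record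
    { invariant    = invariant rest
    ; backward     = backward first ∘ backward rest
    -- Valuations are precomposed with renamings, so the later renaming acts first on variables.
    ; rename       = rename first ∘ rename rest
    ; rename-old   = λ old → trans (cong (rename first) (rename-old rest old)) (rename-old first old)
    ; forward      = forward rest ∘ forward first
    }
    where
    first = step-preserves inv step
    rest  = run-preserves (invariant first) steps

  -- From a successful run to a most general unifier

  mostGeneralUnifier : ∀ C → All IsNormalConstraint C → (∀ i → i ∈ varsᶜ C → ¬ Fresh i) →
                       ∀ θ → (C ︔ id) ⇝* ([] ︔ θ) → MostGeneralUnifier θ C
  mostGeneralUnifier C nf old θ run = unifies , mostGeneral
    where
    initial : Invariant C id
    initial = record
      { normal = All.map (λ (N , M , l≡ , m≡ , _) → (N , l≡) , (M , m≡)) nf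
      ; dom-∉ᶜ = λ d → contradiction refl d
      ; dom-∉  = λ d → contradiction refl d
      }

    P : Preserves C id [] θ
    P = run-preserves initial run

    -- The variables of `θ j` lie outside the domain, so `θ` fixes them. With no constraints left,
    -- every valuation read through `θ` therefore solves the final state.
    idempotent : ∀ x j → ⟦ θ j ⟧ x ≡ ⟦ θ j ⟧ (λ k → ⟦ θ k ⟧ x)
    idempotent x j = ⟦⟧-cong (θ j) λ k k∈ →
      sym (cong (flip ⟦_⟧ x) (¬Dom⇒var θ λ d → dom-∉ (invariant P) d j k∈))

    unifies : θ ⊨ C
    unifies = All.tabulate λ {(l , m)} c∈ → ≗⇒≃ λ x →
      trans (⟦⟧-subst l θ x) (trans
        (All.lookup (solves (backward P ([] , idempotent x))) c∈)
        (sym (⟦⟧-subst m θ x)))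

    mostGeneral : ∀ τ → τ ⊨ C → ∃[ τ′ ] (∀ i → i ∈ varsᶜ C → τ i ≃ θ i [ τ′ ])
    -- Pushing the values of `τ` forward through the run precomposes them with `rename P`, and
    -- `fixed` then is the factorization. Variables of `C` are not fresh, so the renaming leaves
    -- them in place.
    mostGeneral τ τ⊨C = τ ∘ rename P , λ i i∈ → ≗⇒≃ λ x → begin
      ⟦ τ i ⟧ x                            ≡⟨ cong (λ j → ⟦ τ j ⟧ x) (rename-old P (old i i∈)) ⟨
      ⟦ τ (rename P i) ⟧ x                 ≡⟨ fixed (forward P (solution x)) i ⟩
      ⟦ θ i ⟧ (λ j → ⟦ τ (rename P j) ⟧ x) ≡⟨ ⟦⟧-subst (θ i) (τ ∘ rename P) x ⟨
      ⟦ θ i [ τ ∘ rename P ] ⟧ x           ∎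
      where
      open ≡-Reasoning
      solution : ∀ x → (λ i → ⟦ τ i ⟧ x) ⊩ C ︔ id
      solution x = All.map (λ {(l , m)} e →
        trans (sym (⟦⟧-subst l τ x)) (trans (≃⇒≗ e x) (⟦⟧-subst m τ x))) τ⊨C , λ _ → refl

mainTheorem11 : ∀ {a ℓ p} (𝓥 : LevelVariables a ℓ p) →
    let open Unification 𝓥 in
    (C : Constraints) →
    All IsNormalConstraint C →
    (∀ i → i ∈ varsᶜ C → ¬ Fresh i) →
    (θ : Subst) →
    (C ︔ id) ⇝* ([] ︔ θ) →
    MostGeneralUnifier θ C
mainTheorem11 𝓥 = MostGeneral.mostGeneralUnifier 𝓥
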